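{- Let $n_1>\dots>n_k$ and $m_1>\dots>m_\ell$ be positive integers with $(n_1,\dots,n_k)\succ(m_1,\dots,m_\ell)$. If $F_{2n_1+1}F_{2n_2+1}\cdots F_{2n_k+1}=F_{2m_1+1}F_{2m_2+1}\cdots F_{2m_\ell+1}$, then $k=\ell$ and $m_i=n_i$ for all $i$.
   Context: $F_n$ is the Fibonacci sequence with $F_0=1$, $F_1=1$, $F_{n+2}=F_{n+1}+F_n$ for $n\ge0$. Majorization: for finite non-increasing sequences of positive integers $(a_1,\dots,a_n)$ and $(b_1,\dots,b_k)$, write $(a_1,\dots,a_n)\succ(b_1,\dots,b_k)$ if: (1) $n\le k$; (2) for every $i\le n$, $a_1+\dots+a_i\ge b_1+\dots+b_i$; (3) $a_1+\dots+a_n\ge b_1+\dots+b_k$. -}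

module Defs where

open import Data.Nat using (ℕ; zero; suc; _+_; _*_; _≤_; _<_; _>_)
open import Data.List using (List; []; _∷_; length; take; map)
open import Data.Nat.ListAction using (sum; product)
open import Data.List.Relation.Unary.All using (All)
open import Data.List.Relation.Unary.Linked using (Linked)

F : ℕ → ℕ
F zero = 1
F (suc zero) = 1
F (suc (suc n)) = F (suc n) + F n

StrictDec : List ℕ → Set
StrictDec = Linked _>_

Positive : List ℕ → Set
Positive = All (λ x → 0 < x)

record _≻_ (as bs : List ℕ) : Set where
  field
    len≤   : length as ≤ length bs
    prefix : ∀ i → i ≤ length as → sum (take i bs) ≤ sum (take i as)
    total  : sum bs ≤ sum as

Fodd : ℕ → ℕ
Fodd n = F (2 * n + 1)

FibProd : List ℕ → ℕ
FibProd ns = product (map Fodd ns)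

{-# OPTIONS --safe #-}
module Submission where

-- With φ the golden ratio and α = φ², put u n = (α^n − α^(−n)) / √5, so that Fodd n = u (n + 1).
-- If the lists differ, cancel the common leading terms; the larger of the two heads then gives an
-- index N ≥ 2 such that u N divides a product of u j with 0 < j < N. This contradicts Carmichael's
-- theorem on primitive divisors, which is proved here for u: let L be the least common multiple of
-- the u (N / q), q ranging over the primes dividing N. A prime p dividing both d = u N / L and
-- some u j with 0 < j < N divides N, and p² does not divide d, so d divides the radical of N.
-- On the other hand d is about α^(totient N), which is too large unless N = 6; and
-- u 6 = 144 does not divide u 2 u 3 u 4 u 5 = 27720.
open import Defs
open import Data.Empty using (⊥)
open import Data.List using (List; []; _∷_; length; map; filter; upTo; downFrom)
open import Data.List.Membership.Propositional using (_∈_)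
open import Data.List.Membership.Propositional.Properties using (∈-filter⁺; ∈-upTo⁺)
open import Data.List.Relation.Unary.All as All using (All; []; _∷_)
open import Data.List.Relation.Unary.All.Properties using (all-filter)
open import Data.List.Relation.Unary.AllPairs as AllPairs using (AllPairs; []; _∷_)
import Data.List.Relation.Unary.AllPairs.Properties as AllPairs
open import Data.List.Relation.Unary.Any using (here; there)
open import Data.List.Relation.Unary.Linked.Properties using (Linked⇒AllPairs)
open import Data.Nat
open import Data.Nat.Coprimality as Coprimality using (Coprime; coprime-divisor; coprime⇒gcd≡1; prime⇒coprime)
open import Data.Nat.Divisibility
open import Data.Nat.DivMod using (_%_; _/_; m%n<n; m≡m%n+[m/n]*n)
open import Data.Nat.GCD using (gcd; gcd-GCD; gcd[m,n]∣m; gcd[m,n]∣n; gcd-greatest; c*gcd[m,n]≡gcd[cm,cn]; module Bézout)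
open import Data.Nat.LCM using (lcm; m∣lcm[m,n]; n∣lcm[m,n]; lcm-least; gcd*lcm)
open import Data.Nat.ListAction using (product)
open import Data.Nat.ListAction.Properties using (product≢0)
open import Data.Nat.Primality
  using (Prime; prime?; prime[2]; ¬prime[0]; ¬prime[1]; euclidsLemma; prime⇒irreducible; prime⇒nonTrivial; prime⇒nonZero; productOfPrimes≢0)
open import Data.Nat.Primality.Factorisation using (factorise)
open import Data.Nat.Properties
open import Data.Nat.Tactic.RingSolver using (solve-∀)
open import Data.Product using (∃-syntax; _×_; _,_; proj₁; proj₂)
open import Data.Sum using (inj₁; inj₂)
open import Function using (flip; it)
open import Relation.Binary using (tri<; tri≈; tri>)
open import Relation.Binary.PropositionalEquality
open import Relation.Nullary using (¬_; yes; no; contradiction)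
open import Relation.Nullary.Decidable using (toWitnessFalse; _×-dec_)

-- The sequence `u`: Fibonacci numbers, addition formulas, growth.

-- Coordinates of α^n = w n + u n φ.
mutual
  u : ℕ → ℕ
  u zero    = 0
  u (suc n) = 2 * u n + w n

  w : ℕ → ℕ
  w zero    = 1
  w (suc n) = u n + w n

u-F : ∀ n → u (suc n) ≡ F (1 + 2 * n) × w (suc n) ≡ F (2 * n)
u-F zero = refl , refl
u-F (suc n) with u-F n
... | eu , ew =
  trans (cong₂ (λ a b → 2 * a + b) eu ew)
    (trans (lemma (F (1 + 2 * n)) (F (2 * n))) (cong (λ k → F (1 + k)) (sym (*-suc 2 n)))) ,
  trans (cong₂ _+_ eu ew) (cong F (sym (*-suc 2 n)))
  where
  lemma : ∀ a b → 2 * a + b ≡ a + b + a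
  lemma = solve-∀

u≡Fodd : ∀ n → u (suc n) ≡ Fodd n
u≡Fodd n = trans (proj₁ (u-F n)) (cong F (+-comm 1 (2 * n)))

mutual
  -- The φ-coordinate of α^a α^b, multiplied out with φ² = φ + 1; `w-+` is the other coordinate.
  u-+ : ∀ a b → u (a + b) ≡ u a * (u b + w b) + w a * u b
  u-+ zero b = sym (+-identityʳ (u b))
  u-+ (suc a) b rewrite u-+ a b | w-+ a b = lemma (u a) (w a) (u b) (w b)
    where
    lemma : ∀ x y z t → 2 * (x * (z + t) + y * z) + (x * z + y * t) ≡ (2 * x + y) * (z + t) + (x + y) * z
    lemma = solve-∀

  w-+ : ∀ a b → w (a + b) ≡ u a * u b + w a * w b
  w-+ zero b = sym (+-identityʳ (w b))
  w-+ (suc a) b rewrite u-+ a b | w-+ a b = lemma (u a) (w a) (u b) (w b)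
    where
    lemma : ∀ x y z t → (x * (z + t) + y * z) + (x * z + y * t) ≡ (2 * x + y) * z + (x + y) * t
    lemma = solve-∀

-- The norm of w + u φ in ℤ[φ] is w² + u w - u², and α is a unit of norm 1.
norm : ∀ n → w n * w n + u n * w n ≡ 1 + u n * u n
norm zero = refl
norm (suc n) = begin
  (u n + w n) * (u n + w n) + (2 * u n + w n) * (u n + w n) ≡⟨ l₁ (u n) (w n) ⟩
  3 * (u n * u n) + 4 * (u n * w n) + w n * w n + (w n * w n + u n * w n) ≡⟨ cong (3 * (u n * u n) + 4 * (u n * w n) + w n * w n +_) (norm n) ⟩
  3 * (u n * u n) + 4 * (u n * w n) + w n * w n + (1 + u n * u n) ≡⟨ l₂ (u n) (w n) ⟩
  1 + (2 * u n + w n) * (2 * u n + w n) ∎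
  where
  open ≡-Reasoning
  l₁ : ∀ x y → (x + y) * (x + y) + (2 * x + y) * (x + y) ≡ 3 * (x * x) + 4 * (x * y) + y * y + (y * y + x * y)
  l₁ = solve-∀
  l₂ : ∀ x y → 3 * (x * x) + 4 * (x * y) + y * y + (1 + x * x) ≡ 1 + (2 * x + y) * (2 * x + y)
  l₂ = solve-∀

w>0 : ∀ n → 0 < w n
w>0 zero    = z<s
w>0 (suc n) = <-≤-trans (w>0 n) (m≤n+m (w n) (u n))

u>0 : ∀ n → 0 < u (suc n)
u>0 n = <-≤-trans (w>0 n) (m≤n+m (w n) (2 * u n))

u≤2w : ∀ n → u n ≤ 2 * w n
u≤2w zero    = z≤n
u≤2w (suc n) = begin
  2 * u n + w n         ≤⟨ +-monoʳ-≤ (2 * u n) (m≤m+n (w n) (1 * w n)) ⟩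
  2 * u n + 2 * w n     ≡⟨ sym (*-distribˡ-+ 2 (u n) (w n)) ⟩
  2 * (u n + w n)       ∎
  where open ≤-Reasoning

-- The ratio of consecutive terms tends to α = 2.618...; the rational bound 5/2 leaves enough room
-- in the final estimate.
u-growth : ∀ n → 5 * u n ≤ 2 * u (suc n)
u-growth n = begin
  5 * u n                     ≡⟨ lemma₁ (u n) ⟩
  4 * u n + u n               ≤⟨ +-monoʳ-≤ (4 * u n) (u≤2w n) ⟩
  4 * u n + 2 * w n           ≡⟨ lemma₂ (u n) (w n) ⟩
  2 * (2 * u n + w n)         ∎
  where
  open ≤-Reasoning
  lemma₁ : ∀ x → 5 * x ≡ 4 * x + x
  lemma₁ = solve-∀
  lemma₂ : ∀ x y → 4 * x + 2 * y ≡ 2 * (2 * x + y)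
  lemma₂ = solve-∀

-- In the closed form the mixed terms α^(a - b) and α^(b - a) of the two products cancel. The
-- identity measures how far `u` is from obeying α^a α^b = α^(a + b).
u-*-+ : ∀ a b → u (suc a) * u (suc b) ≡ u (suc (a + b)) + u a * u b
u-*-+ a b rewrite u-+ a b | w-+ a b = lemma (u a) (w a) (u b) (w b)
  where
  lemma : ∀ x y z t → (2 * x + y) * (2 * z + t) ≡ 2 * (x * (z + t) + y * z) + (x * z + y * t) + x * z
  lemma = solve-∀

u-supermult : ∀ a b → u (suc (a + b)) ≤ u (suc a) * u (suc b)
u-supermult a b rewrite u-*-+ a b = m≤m+n _ _

-- The right side expands to 3 u u + 2 u w + 2 w u + w w, and by `u≤2w` each doubled mixed product
-- is at least u u. So the error term in `u-*-+` is at most a fifth, whence the factor 6/5 in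
-- `u-submult`.
5u*u≤u : ∀ a b → 5 * (u a * u b) ≤ u (suc (a + b))
5u*u≤u a b = begin
  5 * (u a * u b)                                                            ≡⟨ l₁ (u a * u b) ⟩
  3 * (u a * u b) + (u a * u b + u a * u b)                                  ≤⟨ +-monoʳ-≤ (3 * (u a * u b))
                                                                                  (+-mono-≤ (*-monoʳ-≤ (u a) (u≤2w b)) (*-monoˡ-≤ (u b) (u≤2w a))) ⟩
  3 * (u a * u b) + (u a * (2 * w b) + 2 * w a * u b)                        ≤⟨ m≤m+n _ (w a * w b) ⟩
  3 * (u a * u b) + (u a * (2 * w b) + 2 * w a * u b) + w a * w b            ≡⟨ l₂ (u a) (w a) (u b) (w b) ⟩
  2 * (u a * (u b + w b) + w a * u b) + (u a * u b + w a * w b)              ≡⟨ cong₂ (λ x y → 2 * x + y) (sym (u-+ a b)) (sym (w-+ a b)) ⟩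
  u (suc (a + b))                                                            ∎
  where
  open ≤-Reasoning
  l₁ : ∀ x → 5 * x ≡ 3 * x + (x + x)
  l₁ = solve-∀
  l₂ : ∀ x y z t → 3 * (x * z) + (x * (2 * t) + 2 * y * z) + y * t ≡ 2 * (x * (z + t) + y * z) + (x * z + y * t)
  l₂ = solve-∀

u-submult : ∀ a b → 5 * (u (suc a) * u (suc b)) ≤ 6 * u (suc (a + b))
u-submult a b = begin
  5 * (u (suc a) * u (suc b))                  ≡⟨ cong (5 *_) (u-*-+ a b) ⟩
  5 * (u (suc (a + b)) + u a * u b)            ≡⟨ *-distribˡ-+ 5 (u (suc (a + b))) (u a * u b) ⟩
  5 * u (suc (a + b)) + 5 * (u a * u b)        ≤⟨ +-monoʳ-≤ (5 * u (suc (a + b))) (5u*u≤u a b) ⟩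
  5 * u (suc (a + b)) + u (suc (a + b))        ≡⟨ +-comm (5 * u (suc (a + b))) _ ⟩
  6 * u (suc (a + b))                          ∎
  where open ≤-Reasoning

u-lower : ∀ t → 5 ^ t ≤ 2 ^ t * u (suc t)
u-lower zero    = ≤-refl
u-lower (suc t) = begin
  5 * 5 ^ t                           ≤⟨ *-monoʳ-≤ 5 (u-lower t) ⟩
  5 * (2 ^ t * u (suc t))             ≡⟨ l₁ (2 ^ t) (u (suc t)) ⟩
  2 ^ t * (5 * u (suc t))             ≤⟨ *-monoʳ-≤ (2 ^ t) (u-growth (suc t)) ⟩
  2 ^ t * (2 * u (suc (suc t)))       ≡⟨ l₂ (2 ^ t) (u (suc (suc t))) ⟩
  2 * 2 ^ t * u (suc (suc t))         ∎
  where
  open ≤-Reasoning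
  l₁ : ∀ x y → 5 * (x * y) ≡ x * (5 * y)
  l₁ = solve-∀
  l₂ : ∀ x y → x * (2 * y) ≡ 2 * x * y
  l₂ = solve-∀

-- Strong divisibility of `u`.

-- By `norm`, a common divisor of `u n` and `w n` divides 1.
∣u⇒coprime-w : ∀ {x} n → x ∣ u n → Coprime x (w n)
∣u⇒coprime-w n x∣u {d} (d∣x , d∣w) = ∣1⇒≡1 (∣m+n∣m⇒∣n
  (subst (d ∣_) (trans (norm n) (+-comm 1 (u n * u n)))
    (∣m∣n⇒∣m+n (∣m⇒∣m*n (w n) d∣w) (∣n⇒∣m*n (u n) d∣w)))
  (∣m⇒∣m*n (u n) (∣-trans d∣x x∣u)))

u-∣-* : ∀ m k → u m ∣ u (k * m)
u-∣-* m zero    = u m ∣0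
u-∣-* m (suc k) rewrite u-+ m (k * m) = ∣m∣n⇒∣m+n (∣m⇒∣m*n _ ∣-refl) (∣n⇒∣m*n (w m) (u-∣-* m k))

u-∣ : ∀ {m n} → m ∣ n → u m ∣ u n
u-∣ {m} (divides k refl) = u-∣-* m k

-- Modulo `u c`, the addition formula reduces `u (g + c)` to `u g * w c`, and `w c` is coprime to x.
∣u-cancel-+ : ∀ {x} g c → x ∣ u c → x ∣ u (g + c) → x ∣ u g
∣u-cancel-+ {x} g c x∣uc x∣ug+c = coprime-divisor (∣u⇒coprime-w c x∣uc)
  (subst (x ∣_) (*-comm (u g) (w c)) (∣m+n∣m⇒∣n
    (subst (x ∣_) (trans (u-+ g c) (lemma (u g) (w g) (u c) (w c))) x∣ug+c)
    (∣n⇒∣m*n (u g + w g) x∣uc)))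
  where
  lemma : ∀ a b z t → a * (z + t) + b * z ≡ (a + b) * z + a * t
  lemma = solve-∀

-- Subtraction-free Bézout writes a multiple of one index as the gcd plus a multiple of the other,
-- which `∣u-cancel-+` removes.
∣u-gcd : ∀ {x} m n → x ∣ u m → x ∣ u n → x ∣ u (gcd m n)
∣u-gcd {x} m n x∣um x∣un with Bézout.identity (gcd-GCD m n)
... | Bézout.+- a b eq = ∣u-cancel-+ (gcd m n) (b * n) (∣-trans x∣un (u-∣-* n b))
      (subst (λ z → x ∣ u z) (sym eq) (∣-trans x∣um (u-∣-* m a)))
... | Bézout.-+ a b eq = ∣u-cancel-+ (gcd m n) (a * m) (∣-trans x∣um (u-∣-* m a))
      (subst (λ z → x ∣ u z) (sym eq) (∣-trans x∣un (u-∣-* n b)))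

-- Prime factors of u (p m) / u m.

-- The binomial coefficient C(j + 2, 2).
triangle : ℕ → ℕ
triangle zero    = 1
triangle (suc j) = triangle j + (2 + j)

2*triangle : ∀ j → 2 * triangle j ≡ (2 + j) * (1 + j)
2*triangle zero    = refl
2*triangle (suc j) = trans (*-distribˡ-+ 2 (triangle j) (2 + j)) (trans (cong (_+ 2 * (2 + j)) (2*triangle j)) (lemma j))
  where
  lemma : ∀ j → (2 + j) * (1 + j) + 2 * (2 + j) ≡ (3 + j) * (2 + j)
  lemma = solve-∀

-- Binomial expansion of (w + u φ)^(j+2), using φ² = φ + 1.
power-expansion : ∀ m j → ∃[ X ] ∃[ Y ]
  w ((2 + j) * m) ≡ w m ^ (2 + j) + u m * u m * Y ×
  u ((2 + j) * m) ≡ u m * ((2 + j) * w m ^ (1 + j) + triangle j * w m ^ j * u m + u m * u m * X)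
power-expansion m zero = 0 , 1 ,
  trans (cong (λ z → w (m + z)) (+-identityʳ m)) (trans (w-+ m m) (l₁ (u m) (w m))) ,
  trans (cong (λ z → u (m + z)) (+-identityʳ m)) (trans (u-+ m m) (l₂ (u m) (w m)))
  where
  l₁ : ∀ x y → x * x + y * y ≡ y * (y * 1) + x * x * 1
  l₁ = solve-∀
  l₂ : ∀ x y → x * (x + y) + y * x ≡ x * (2 * (y * 1) + 1 * 1 * x + x * x * 0)
  l₂ = solve-∀
power-expansion m (suc j) with power-expansion m j
... | X , Y , eqw , equ =
  triangle j * w m ^ j + X * (u m + w m) + Y ,
  (2 + j) * w m ^ (1 + j) + triangle j * w m ^ j * u m + u m * u m * X + w m * Y ,
  trans (w-+ m ((2 + j) * m)) (trans (cong₂ (λ a b → u m * a + w m * b) equ eqw)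
    (l₁ (u m) (w m) (w m ^ j) (triangle j) j X Y)) ,
  trans (u-+ m ((2 + j) * m)) (trans (cong₂ (λ a b → u m * (a + b) + w m * a) equ eqw)
    (l₂ (u m) (w m) (w m ^ j) (triangle j) j X Y))
  where
  l₁ : ∀ x y p t j X Y →
    x * (x * ((2 + j) * (y * p) + t * p * x + x * x * X)) + y * (y * (y * p) + x * x * Y)
    ≡ y * (y * (y * p)) + x * x * ((2 + j) * (y * p) + t * p * x + x * x * X + y * Y)
  l₁ = solve-∀
  l₂ : ∀ x y p t j X Y →
    x * (x * ((2 + j) * (y * p) + t * p * x + x * x * X) + (y * (y * p) + x * x * Y)) + y * (x * ((2 + j) * (y * p) + t * p * x + x * x * X))
    ≡ x * ((3 + j) * (y * (y * p)) + (t + (2 + j)) * (y * p) * x + x * x * (t * p + X * (x + y) + Y))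
  l₂ = solve-∀

∣m+n∣n⇒∣m : ∀ {d m n} → d ∣ m + n → d ∣ n → d ∣ m
∣m+n∣n⇒∣m {d} {m} {n} d∣m+n = ∣m+n∣m⇒∣n (subst (d ∣_) (+-comm m n) d∣m+n)

prime∤1 : ∀ {p} → Prime p → ¬ p ∣ 1
prime∤1 pp p∣1 = ¬prime[1] (subst Prime (∣1⇒≡1 p∣1) pp)

prime∣^ : ∀ {p} → Prime p → ∀ a k → p ∣ a ^ k → p ∣ a
prime∣^ pp a zero    d = contradiction d (prime∤1 pp)
prime∣^ pp a (suc k) d with euclidsLemma a (a ^ k) pp d
... | inj₁ p∣a = p∣a
... | inj₂ p∣  = prime∣^ pp a k p∣

prime∣prime : ∀ {p q} → Prime p → Prime q → p ∣ q → p ≡ q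
prime∣prime pp pq p∣q with prime⇒irreducible pq p∣q
... | inj₁ refl = contradiction pp ¬prime[1]
... | inj₂ p≡q  = p≡q

prime∤w : ∀ {p} n → Prime p → p ∣ u n → ¬ p ∣ w n
prime∤w n pp p∣u p∣w = ¬prime[1] (subst Prime (∣u⇒coprime-w n p∣u (∣-refl , p∣w)) pp)

module _ {m W : ℕ} .{{_ : NonZero (u m)}} where

  quotient-expansion : ∀ j → u ((2 + j) * m) ≡ u m * W → ∃[ X ]
    W ≡ (2 + j) * w m ^ (1 + j) + triangle j * w m ^ j * u m + u m * u m * X
  quotient-expansion j eq with power-expansion m j
  ... | X , _ , _ , e = X , *-cancelˡ-≡ _ _ (u m) (trans (sym eq) e)

  -- Modulo p, where `u m` vanishes, W is q w^(q - 1) with q = 2 + j, and p does not divide `w m`.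
  prime∣quotient⇒∣index : ∀ {p} → Prime p → ∀ j → u ((2 + j) * m) ≡ u m * W →
    p ∣ u m → p ∣ W → p ∣ 2 + j
  prime∣quotient⇒∣index {p} pp j eq p∣u p∣W with quotient-expansion j eq
  ... | X , refl with euclidsLemma (2 + j) (w m ^ (1 + j)) pp
          (∣m+n∣n⇒∣m (∣m+n∣n⇒∣m p∣W (∣m⇒∣m*n X (∣m⇒∣m*n (u m) p∣u))) (∣n⇒∣m*n (triangle j * w m ^ j) p∣u))
  ...   | inj₁ p∣q = p∣q
  ...   | inj₂ p∣w = contradiction (prime∣^ pp (w m) (1 + j) p∣w) (prime∤w m pp p∣u)

  -- For odd p = 3 + j the coefficient C(p, 2) is a multiple of p, so modulo p² only the term p w^(p
  -- - 1) of W survives.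
  prime²∤quotient-odd : ∀ j → Prime (3 + j) → u ((3 + j) * m) ≡ u m * W →
    3 + j ∣ u m → ¬ (3 + j) * (3 + j) ∣ W
  prime²∤quotient-odd j pp eq p∣u@(divides e u≡ep) p²∣W with quotient-expansion (suc j) eq
  ... | X , refl = prime∤w m pp p∣u (prime∣^ pp (w m) (2 + j) (*-cancelˡ-∣ p
          (∣m+n∣n⇒∣m (∣m+n∣n⇒∣m p²∣W (∣m⇒∣m*n X (*-pres-∣ p∣u p∣u))) (*-pres-∣ (∣m⇒∣m*n (w m ^ suc j) p∣t) p∣u))))
    where
    p = 3 + j
    p∣t : p ∣ triangle (suc j)
    p∣t with euclidsLemma 2 (triangle (suc j)) pp (subst (p ∣_) (sym (2*triangle (suc j))) (∣m⇒∣m*n (2 + j) ∣-refl))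
    ... | inj₁ p∣2 = contradiction (∣⇒≤ p∣2) λ { (s≤s (s≤s ())) }
    ... | inj₂ d   = d

-- Modulo 4 the right side is 1 + v², which is 1 or 2.
4z²≢1+5v² : ∀ z v → 4 * (z * z) ≢ 1 + 5 * (v * v)
4z²≢1+5v² z v eq = go (v % 4) (m%n<n v 4) (m≡m%n+[m/n]*n v 4)
  where
  lemma : ∀ r s → 1 + 5 * ((r + s * 4) * (r + s * 4)) ≡ (1 + 5 * (r * r)) + 4 * (10 * r * s + 20 * s * s)
  lemma = solve-∀
  go : ∀ r → r < 4 → v ≡ r + v / 4 * 4 → ⊥
  go r r<4 v≡ = check r r<4 (∣m+n∣n⇒∣m
    (subst (4 ∣_) (trans eq (trans (cong (λ v → 1 + 5 * (v * v)) v≡) (lemma r (v / 4)))) (m∣m*n (z * z)))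
    (m∣m*n (10 * r * (v / 4) + 20 * (v / 4) * (v / 4))))
    where
    check : ∀ r → r < 4 → 4 ∣ 1 + 5 * (r * r) → ⊥
    check 0 _ = toWitnessFalse {a? = 4 ∣? 1} _
    check 1 _ = toWitnessFalse {a? = 4 ∣? 6} _
    check 2 _ = toWitnessFalse {a? = 4 ∣? 21} _
    check 3 _ = toWitnessFalse {a? = 4 ∣? 46} _
    check (suc (suc (suc (suc _)))) (s≤s (s≤s (s≤s (s≤s ()))))

-- The linear term of the expansion has coefficient C(p,2), which p divides only for odd p.
2²∤quotient : ∀ {m W} .{{_ : NonZero (u m)}} → u (2 * m) ≡ u m * W → 2 ∣ u m → ¬ 4 ∣ W
2²∤quotient {m} {W} eq (divides v u≡v2) (divides z W≡z4) = 4z²≢1+5v² z v (begin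
  -- Since u m = 2 v and W = 2 w m + u m, W = 4 z means 2 z = w m + v. Squaring this and eliminating
  -- `w m` by `norm` gives an equation that fails modulo 4.
  4 * (z * z)                                  ≡⟨ l₁ z ⟩
  (z * 2) * (z * 2)                            ≡⟨ cong₂ _*_ z2≡ z2≡ ⟩
  (w m + v) * (w m + v)                        ≡⟨ l₂ (w m) v ⟩
  w m * w m + v * 2 * w m + v * v              ≡⟨ cong (λ a → w m * w m + a * w m + v * v) (sym u≡v2) ⟩
  w m * w m + u m * w m + v * v                ≡⟨ cong (_+ v * v) (norm m) ⟩
  1 + u m * u m + v * v                        ≡⟨ cong (λ a → 1 + a * a + v * v) u≡v2 ⟩
  1 + v * 2 * (v * 2) + v * v                  ≡⟨ l₃ v ⟩
  1 + 5 * (v * v)                              ∎)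
  where
  open ≡-Reasoning
  l₁ : ∀ z → 4 * (z * z) ≡ (z * 2) * (z * 2)
  l₁ = solve-∀
  l₂ : ∀ w v → (w + v) * (w + v) ≡ w * w + v * 2 * w + v * v
  l₂ = solve-∀
  l₃ : ∀ v → 1 + v * 2 * (v * 2) + v * v ≡ 1 + 5 * (v * v)
  l₃ = solve-∀
  l₄ : ∀ u w → u * (2 * w + u) ≡ u * (u + w) + w * u
  l₄ = solve-∀
  l₅ : ∀ w v → 2 * w + v * 2 ≡ (w + v) * 2
  l₅ = solve-∀
  l₆ : ∀ z → z * 2 * 2 ≡ z * 4
  l₆ = solve-∀
  W≡ : W ≡ 2 * w m + u m
  W≡ = *-cancelˡ-≡ _ _ (u m) (begin
    u m * W                              ≡⟨ sym eq ⟩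
    u (m + (m + 0))                      ≡⟨ cong (λ k → u (m + k)) (+-identityʳ m) ⟩
    u (m + m)                            ≡⟨ u-+ m m ⟩
    u m * (u m + w m) + w m * u m        ≡⟨ sym (l₄ (u m) (w m)) ⟩
    u m * (2 * w m + u m)                ∎)
  z2≡ : z * 2 ≡ w m + v
  z2≡ = *-cancelʳ-≡ _ _ 2 (begin
    z * 2 * 2              ≡⟨ l₆ z ⟩
    z * 4                  ≡⟨ sym W≡z4 ⟩
    W                      ≡⟨ W≡ ⟩
    2 * w m + u m          ≡⟨ cong (2 * w m +_) u≡v2 ⟩
    2 * w m + v * 2        ≡⟨ l₅ (w m) v ⟩
    (w m + v) * 2          ∎)

prime²∤quotient : ∀ {p m W} .{{_ : NonZero (u m)}} → Prime p → u (p * m) ≡ u m * W →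
  p ∣ u m → ¬ p * p ∣ W
prime²∤quotient {0} pp = contradiction pp ¬prime[0]
prime²∤quotient {1} pp = contradiction pp ¬prime[1]
prime²∤quotient {2} {m} pp = 2²∤quotient {m}
prime²∤quotient {suc (suc (suc j))} {m} pp = prime²∤quotient-odd {m} j pp

-- Least common multiples of the u (N / q).

∣-nonZero : ∀ {x y} .{{_ : NonZero y}} → x ∣ y → NonZero x
∣-nonZero {x} {y} x∣y = >-nonZero (n≢0⇒n>0 λ x≡0 → ≢-nonZero⁻¹ y (0∣⇒≡0 (subst (_∣ y) x≡0 x∣y)))

-- Distributivity of gcd over lcm: a divisor x of `lcm a b` divides the lcm of `gcd x a` and
-- `gcd x b`.
∣lcm⇒∣ : ∀ {x a b c} .{{_ : NonZero x}} → x ∣ lcm a b → gcd x a ∣ c → gcd x b ∣ c → x ∣ c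
∣lcm⇒∣ {x} {a} {b} {c} x∣lcm A∣c B∣c = ∣-trans x∣lcmAB (lcm-least A∣c B∣c)
  where
  A = gcd x a
  B = gcd x b
  g = gcd A B
  g∣A = gcd[m,n]∣m A B
  g∣x = ∣-trans g∣A (gcd[m,n]∣m x a)
  g∣a = ∣-trans g∣A (gcd[m,n]∣n x a)
  g∣b = ∣-trans (gcd[m,n]∣n A B) (gcd[m,n]∣n x b)
  instance
    g≢0 : NonZero g
    g≢0 = ∣-nonZero g∣x
  -- Multiplication by g turns lcms into products via `gcd*lcm`; then a and b give way to A and B
  -- one at a time, as g x also divides b x and A x.
  gx∣ab : g * x ∣ a * b
  gx∣ab = subst (g * x ∣_) (gcd*lcm a b) (*-pres-∣ (gcd-greatest g∣a g∣b) x∣lcm)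
  gx∣Ab : g * x ∣ A * b
  gx∣Ab = subst (g * x ∣_) (trans (sym (c*gcd[m,n]≡gcd[cm,cn] b x a)) (*-comm b A))
    (gcd-greatest (*-pres-∣ g∣b ∣-refl) (subst (g * x ∣_) (*-comm a b) gx∣ab))
  gx∣AB : g * x ∣ A * B
  gx∣AB = subst (g * x ∣_) (sym (c*gcd[m,n]≡gcd[cm,cn] A x b))
    (gcd-greatest (*-pres-∣ g∣A ∣-refl) gx∣Ab)
  x∣lcmAB : x ∣ lcm A B
  x∣lcmAB = *-cancelˡ-∣ g (subst (g * x ∣_) (sym (gcd*lcm A B)) gx∣AB)

-- The least common multiple of u (N / q) over q ∈ S, where N = n ∏ S.
properLcm : ℕ → List ℕ → ℕ
properLcm n []      = 1
properLcm n (q ∷ S) = lcm (properLcm (q * n) S) (u (n * product S))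

[q*n]*m≡n*[q*m] : ∀ q n m → (q * n) * m ≡ n * (q * m)
[q*n]*m≡n*[q*m] = solve-∀

properLcm∣u : ∀ n S → properLcm n S ∣ u (n * product S)
properLcm∣u n []      = 1∣ _
properLcm∣u n (q ∷ S) = lcm-least
  (subst (λ k → properLcm (q * n) S ∣ u k) ([q*n]*m≡n*[q*m] q n (product S)) (properLcm∣u (q * n) S))
  (u-∣ (*-monoʳ-∣ n (n∣m*n q)))

properLcm-mono : ∀ q n S → properLcm n S ∣ properLcm (q * n) S
properLcm-mono q n []      = ∣-refl
properLcm-mono q n (r ∷ S) = lcm-least
  (∣-trans (properLcm-mono q (r * n) S) (subst (λ k → properLcm k S ∣ properLcm (q * n) (r ∷ S)) (swap r q n)
     (m∣lcm[m,n] (properLcm (r * (q * n)) S) _)))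
  (∣-trans (u-∣ (*-monoˡ-∣ (product S) (n∣m*n q {n}))) (n∣lcm[m,n] (properLcm (r * (q * n)) S) _))
  where
  swap : ∀ r q n → r * (q * n) ≡ q * (r * n)
  swap = solve-∀

-- Put M = n ∏ S. Distribute gcd over the lcm: for r in S, coprime to q, the gcd of q M / r and M is
-- M / r, and `∣u-gcd` carries this over to `u`.
∣properLcm-gcd : ∀ {x} q n S .{{_ : NonZero x}} → All (Coprime q) S →
  x ∣ properLcm (q * n) S → x ∣ u (n * product S) → x ∣ properLcm n S
∣properLcm-gcd q n []      []          x∣L x∣u = x∣L
∣properLcm-gcd {x} q n (r ∷ S) (q⊥r ∷ q⊥S) x∣L x∣u = ∣lcm⇒∣ x∣L
  (∣-trans (∣properLcm-gcd q (r * n) S {{g≢0}} q⊥S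
      (subst (λ k → g ∣ properLcm k S) (swap r q n) (gcd[m,n]∣n x _))
      (subst (λ k → g ∣ u k) (sym ([q*n]*m≡n*[q*m] r n (product S))) (∣-trans (gcd[m,n]∣m x _) x∣u)))
    (m∣lcm[m,n] (properLcm (r * n) S) _))
  (∣-trans (subst (λ k → gcd x (u (q * n * product S)) ∣ u k) gcd≡
      (∣u-gcd (q * n * product S) (n * (r * product S)) (gcd[m,n]∣n x _) (∣-trans (gcd[m,n]∣m x _) x∣u)))
    (n∣lcm[m,n] (properLcm (r * n) S) _))
  where
  M = product S
  g = gcd x (properLcm (r * (q * n)) S)
  g≢0 : NonZero g
  g≢0 = ∣-nonZero (gcd[m,n]∣m x (properLcm (r * (q * n)) S))
  swap : ∀ r q n → r * (q * n) ≡ q * (r * n)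
  swap = solve-∀
  swap₁ : ∀ q n m → q * n * m ≡ n * m * q
  swap₁ = solve-∀
  swap₂ : ∀ r n m → n * (r * m) ≡ n * m * r
  swap₂ = solve-∀
  gcd≡ : gcd (q * n * M) (n * (r * M)) ≡ n * M
  gcd≡ = begin
    gcd (q * n * M) (n * (r * M))    ≡⟨ cong₂ gcd (swap₁ q n M) (swap₂ r n M) ⟩
    gcd (n * M * q) (n * M * r)      ≡⟨ sym (c*gcd[m,n]≡gcd[cm,cn] (n * M) q r) ⟩
    n * M * gcd q r                  ≡⟨ cong (n * M *_) (coprime⇒gcd≡1 q⊥r) ⟩
    n * M * 1                        ≡⟨ *-identityʳ (n * M) ⟩
    n * M                            ∎
    where open ≡-Reasoning

u-nonZero : ∀ n .{{_ : NonZero n}} → NonZero (u n)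
u-nonZero (suc n) = >-nonZero (u>0 n)

-- `properLcm n S` is the gcd of the two arguments of the lcm defining `properLcm n (q ∷ S)`, so
-- this is gcd · lcm = product. For the quotients u N / L it is the recursion of cyclotomic
-- polynomials: the quotient for `q ∷ S` at N is the one for S at N divided by the one for S at N /
-- q.
properLcm-∷ : ∀ q n S .{{_ : NonZero (n * product S)}} → All (Coprime q) S →
  properLcm n (q ∷ S) * properLcm n S ≡ properLcm (q * n) S * u (n * product S)
properLcm-∷ q n S q⊥S = begin
  lcm a b * properLcm n S    ≡⟨ cong (lcm a b *_) (∣-antisym
                                 (gcd-greatest (properLcm-mono q n S) (properLcm∣u n S))
                                 (∣properLcm-gcd q n S {{∣-nonZero {{u-nonZero _}} (gcd[m,n]∣n a b)}} q⊥S (gcd[m,n]∣m a b) (gcd[m,n]∣n a b))) ⟩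
  lcm a b * gcd a b          ≡⟨ *-comm (lcm a b) (gcd a b) ⟩
  gcd a b * lcm a b          ≡⟨ gcd*lcm a b ⟩
  a * b                      ∎
  where
  open ≡-Reasoning
  a = properLcm (q * n) S
  b = u (n * product S)

-- Size of u N / L.

-- For distinct primes, Euler's totient of their product.
totient : List ℕ → ℕ
totient S = product (map pred S)

-- u N / L is α^t up to a factor (6/5)^k, where multiplication by α^t appears as a shift of the index
-- of u by t. Quantifying over x makes this stable under quotients, without real numbers.
record Near (k t N L : ℕ) : Set where
  field
    lower : ∀ x → 5 ^ k * (L * u (suc (x + t))) ≤ 6 ^ k * (u N * u (suc x))
    upper : ∀ x → 5 ^ k * (u N * u (suc x)) ≤ 6 ^ k * (L * u (suc (x + t)))
open Near

-- By `u-supermult` and `u-submult` both products are within a factor 6/5 of `u` at one common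
-- index. The prime is `suc q`, so that α has exponent `q * n`.
near-[q] : ∀ q n .{{_ : NonZero n}} → Near 1 (q * n) (suc q * n) (u n)
near-[q] q n@(suc m) = record { lower = lo ; upper = up }
  where
  open ≤-Reasoning
  e₁ : ∀ x → m + (x + q * n) ≡ m + q * n + x
  e₁ x = lemma m x (q * n)
    where
    lemma : ∀ m x y → m + (x + y) ≡ m + y + x
    lemma = solve-∀
  lo : ∀ x → 5 ^ 1 * (u n * u (suc (x + q * n))) ≤ 6 ^ 1 * (u (suc q * n) * u (suc x))
  lo x = begin
    5 * (u n * u (suc (x + q * n)))          ≤⟨ u-submult m (x + q * n) ⟩
    6 * u (suc (m + (x + q * n)))            ≡⟨ cong (λ k → 6 * u (suc k)) (e₁ x) ⟩
    6 * u (suc (m + q * n + x))              ≤⟨ *-monoʳ-≤ 6 (u-supermult (m + q * n) x) ⟩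
    6 * (u (suc q * n) * u (suc x))          ∎
  up : ∀ x → 5 ^ 1 * (u (suc q * n) * u (suc x)) ≤ 6 ^ 1 * (u n * u (suc (x + q * n)))
  up x = begin
    5 * (u (suc q * n) * u (suc x))          ≤⟨ u-submult (m + q * n) x ⟩
    6 * u (suc (m + q * n + x))              ≡⟨ cong (λ k → 6 * u (suc k)) (sym (e₁ x)) ⟩
    6 * u (suc (m + (x + q * n)))            ≤⟨ *-monoʳ-≤ 6 (u-supermult m (x + q * n)) ⟩
    6 * (u n * u (suc (x + q * n)))          ∎

-- Dividing the estimate for N, L₁ by the one for M, L₀ subtracts the shifts and multiplies the
-- error factors.
near-∷ : ∀ {k t N L M L₀ L₁} q .{{_ : NonZero L₀}} → Near k t M L₀ → Near k (suc q * t) N L₁ →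
  L * L₀ ≡ L₁ * u M → Near (k + k) (q * t) N L
near-∷ {k} {t} {N} {L} {M} {L₀} {L₁} q near₀ near₁ eq = record { lower = lo ; upper = up }
  where
  open ≤-Reasoning
  e : ∀ x → x + q * t + t ≡ x + suc q * t
  e x = lemma x (q * t) t
    where
    lemma : ∀ x y t → x + y + t ≡ x + (t + y)
    lemma = solve-∀
  c₁ : ∀ a l v l₀ → a * a * (l * v) * l₀ ≡ a * a * (l * l₀ * v)
  c₁ = solve-∀
  c₂ : ∀ a l₁ v m → a * a * (l₁ * m * v) ≡ a * l₁ * (a * (m * v))
  c₂ = solve-∀
  c₃ : ∀ a l₁ l₀ b v → a * l₁ * (b * (l₀ * v)) ≡ b * l₀ * (a * (l₁ * v))
  c₃ = solve-∀
  c₄ : ∀ l₀ b n v → b * l₀ * (b * (n * v)) ≡ b * b * (n * v) * l₀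
  c₄ = solve-∀
  lo : ∀ x → 5 ^ (k + k) * (L * u (suc (x + q * t))) ≤ 6 ^ (k + k) * (u N * u (suc x))
  lo x rewrite ^-distribˡ-+-* 5 k k | ^-distribˡ-+-* 6 k k = *-cancelʳ-≤ _ _ L₀ (begin
    a * a * (L * u (suc y)) * L₀                  ≡⟨ c₁ a L (u (suc y)) L₀ ⟩
    a * a * (L * L₀ * u (suc y))                  ≡⟨ cong (λ z → a * a * (z * u (suc y))) eq ⟩
    a * a * (L₁ * u M * u (suc y))                ≡⟨ c₂ a L₁ (u (suc y)) (u M) ⟩
    -- `near₀` is taken at y = x + q t, so that its shift by t ends at x + suc q * t, as `near₁`
    -- requires.
    a * L₁ * (a * (u M * u (suc y)))              ≤⟨ *-monoʳ-≤ (a * L₁) (upper near₀ y) ⟩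
    a * L₁ * (b * (L₀ * u (suc (y + t))))         ≡⟨ c₃ a L₁ L₀ b (u (suc (y + t))) ⟩
    b * L₀ * (a * (L₁ * u (suc (y + t))))         ≡⟨ cong (λ z → b * L₀ * (a * (L₁ * u (suc z)))) (e x) ⟩
    b * L₀ * (a * (L₁ * u (suc (x + suc q * t)))) ≤⟨ *-monoʳ-≤ (b * L₀) (lower near₁ x) ⟩
    b * L₀ * (b * (u N * u (suc x)))              ≡⟨ c₄ L₀ b (u N) (u (suc x)) ⟩
    b * b * (u N * u (suc x)) * L₀                ∎)
    where
    a = 5 ^ k
    b = 6 ^ k
    y = x + q * t
  up : ∀ x → 5 ^ (k + k) * (u N * u (suc x)) ≤ 6 ^ (k + k) * (L * u (suc (x + q * t)))
  up x rewrite ^-distribˡ-+-* 5 k k | ^-distribˡ-+-* 6 k k = *-cancelʳ-≤ _ _ L₀ (begin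
    a * a * (u N * u (suc x)) * L₀                ≡⟨ sym (c₄ L₀ a (u N) (u (suc x))) ⟩
    a * L₀ * (a * (u N * u (suc x)))              ≤⟨ *-monoʳ-≤ (a * L₀) (upper near₁ x) ⟩
    a * L₀ * (b * (L₁ * u (suc (x + suc q * t)))) ≡⟨ sym (cong (λ z → a * L₀ * (b * (L₁ * u (suc z)))) (e x)) ⟩
    a * L₀ * (b * (L₁ * u (suc (y + t))))         ≡⟨ sym (c₃ b L₁ L₀ a (u (suc (y + t)))) ⟩
    b * L₁ * (a * (L₀ * u (suc (y + t))))         ≤⟨ *-monoʳ-≤ (b * L₁) (lower near₀ y) ⟩
    b * L₁ * (b * (u M * u (suc y)))              ≡⟨ sym (c₂ b L₁ (u (suc y)) (u M)) ⟩
    b * b * (L₁ * u M * u (suc y))                ≡⟨ cong (λ z → b * b * (z * u (suc y))) (sym eq) ⟩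
    b * b * (L * L₀ * u (suc y))                  ≡⟨ sym (c₁ b L (u (suc y)) L₀) ⟩
    b * b * (L * u (suc y)) * L₀                  ∎)
    where
    a = 5 ^ k
    b = 6 ^ k
    y = x + q * t

-- Induction along `properLcm-∷`: one prime has error 6/5, and each further prime doubles the
-- exponent of the error.
near-properLcm : ∀ n q S .{{_ : NonZero n}} → All NonZero (q ∷ S) → AllPairs Coprime (q ∷ S) →
  Near (2 ^ length S) (n * totient (q ∷ S)) (n * product (q ∷ S)) (properLcm n (q ∷ S))
near-properLcm n zero S (record { nonZero = () } ∷ _) _
near-properLcm n (suc q) [] _ _ = subst₂ (λ t N → Near 1 t N (properLcm n (suc q ∷ []))) (l q n) (l (suc q) n)
  (subst (Near 1 (q * n) (suc q * n)) L≡ (near-[q] q n))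
  where
  l : ∀ q n → q * n ≡ n * (q * 1)
  l = solve-∀
  L≡ : u n ≡ lcm 1 (u (n * 1))
  L≡ = ∣-antisym (subst (λ k → u k ∣ lcm 1 (u (n * 1))) (*-identityʳ n) (n∣lcm[m,n] 1 _))
    (lcm-least (1∣ _) (u-∣ (∣-reflexive (*-identityʳ n))))
near-properLcm n (suc q) (r ∷ S) (_ ∷ nz) (q⊥ ∷ ⊥s) =
  subst₂ (λ k t → Near k t (n * product (suc q ∷ r ∷ S)) (properLcm n (suc q ∷ r ∷ S)))
    (cong (2 ^ length S +_) (sym (+-identityʳ _))) (l q n (totient (r ∷ S)))
    (near-∷ q {{∣-nonZero {{u-nonZero (n * product (r ∷ S))}} (properLcm∣u n (r ∷ S))}} (near-properLcm n r S nz ⊥s)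
      (subst₂ (λ t N → Near (2 ^ length S) t N (properLcm (suc q * n) (r ∷ S))) (*-assoc (suc q) n (totient (r ∷ S))) ([q*n]*m≡n*[q*m] (suc q) n (product (r ∷ S)))
        (near-properLcm (suc q * n) r S {{m*n≢0 (suc q) n}} nz ⊥s))
      (properLcm-∷ (suc q) n (r ∷ S) q⊥))
  where
  l : ∀ q n t → q * (n * t) ≡ n * (q * t)
  l = solve-∀
  instance
    M≢0 : NonZero (n * product (r ∷ S))
    M≢0 = m*n≢0 n (product (r ∷ S)) {{it}} {{product≢0 nz}}

-- Elementary inequalities for the size comparison.

24^k≤25^k : ∀ k d → 6 ^ k * 4 ^ (k + d) ≤ 5 ^ k * 5 ^ (k + d)
24^k≤25^k zero    d = +-monoˡ-≤ 0 (^-monoˡ-≤ d (n≤1+n 4))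
24^k≤25^k (suc k) d = begin
  6 * 6 ^ k * (4 * 4 ^ (k + d))      ≡⟨ l₁ (6 ^ k) (4 ^ (k + d)) ⟩
  24 * (6 ^ k * 4 ^ (k + d))         ≤⟨ *-mono-≤ (n≤1+n 24) (24^k≤25^k k d) ⟩
  25 * (5 ^ k * 5 ^ (k + d))         ≡⟨ l₂ (5 ^ k) (5 ^ (k + d)) ⟩
  5 * 5 ^ k * (5 * 5 ^ (k + d))      ∎
  where
  open ≤-Reasoning
  l₁ : ∀ x y → 6 * x * (4 * y) ≡ 24 * (x * y)
  l₁ = solve-∀
  l₂ : ∀ x y → 25 * (x * y) ≡ 5 * x * (5 * y)
  l₂ = solve-∀

-- As (6/5)(4/5) = 24/25 < 1, each factor 6/5 is paid for by a factor 4/5, and t ≥ k supplies enough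
-- of these. One pair, present since k > 0, gives strictness.
6^k*4^t<5^k*5^t : ∀ {k t} → 0 < k → k ≤ t → 6 ^ k * 4 ^ t < 5 ^ k * 5 ^ t
6^k*4^t<5^k*5^t {suc k} {t} _ k<t with m≤n⇒∃[o]m+o≡n k<t
... | d , refl = begin-strict
  6 * 6 ^ k * (4 * 4 ^ (k + d))      ≡⟨ l₁ (6 ^ k) (4 ^ (k + d)) ⟩
  24 * (6 ^ k * 4 ^ (k + d))         ≤⟨ *-monoʳ-≤ 24 (24^k≤25^k k d) ⟩
  24 * (5 ^ k * 5 ^ (k + d))         <⟨ *-monoˡ-< (5 ^ k * 5 ^ (k + d)) {{m*n≢0 _ _ {{m^n≢0 5 k}} {{m^n≢0 5 (k + d)}}}} (n<1+n 24) ⟩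
  25 * (5 ^ k * 5 ^ (k + d))         ≡⟨ l₂ (5 ^ k) (5 ^ (k + d)) ⟩
  5 * 5 ^ k * (5 * 5 ^ (k + d))      ∎
  where
  open ≤-Reasoning
  l₁ : ∀ x y → 6 * x * (4 * y) ≡ 24 * (x * y)
  l₁ = solve-∀
  l₂ : ∀ x y → 25 * (x * y) ≡ 5 * x * (5 * y)
  l₂ = solve-∀

2^length≤totient : ∀ {S} → All (3 ≤_) S → 2 ^ length S ≤ totient S
2^length≤totient []       = ≤-refl
2^length≤totient (b ∷ bs) = *-mono-≤ (pred-mono-≤ b) (2^length≤totient bs)

4+j≤x^[2+j] : ∀ {x} → 2 ≤ x → ∀ j → 4 + j ≤ x ^ (2 + j)
4+j≤x^[2+j] {x} 2≤x zero    = *-mono-≤ 2≤x (*-monoˡ-≤ 1 2≤x)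
4+j≤x^[2+j] {x} 2≤x (suc j) = begin
  5 + j                  ≤⟨ +-monoˡ-≤ (4 + j) (s≤s (z≤n {3 + j})) ⟩
  4 + j + (4 + j)        ≡⟨ cong (4 + j +_) (sym (+-identityʳ (4 + j))) ⟩
  2 * (4 + j)            ≤⟨ *-mono-≤ 2≤x (4+j≤x^[2+j] 2≤x j) ⟩
  x * x ^ (2 + j)        ∎
  where open ≤-Reasoning

0<product : ∀ {S} → All (4 ≤_) S → 0 < product S
0<product []       = z<s
0<product (b ∷ bs) = *-mono-≤ (≤-trans (s≤s z≤n) b) (0<product bs)

-- Let x be twice the product of the tail. For q ≥ 4, q ≤ x^(q - 2), hence q x ≤ x^(q - 1). The
-- factor 2 keeps x ≥ 2.
2*product≤2^totient : ∀ {S} → All (4 ≤_) S → 2 * product S ≤ 2 ^ totient S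
2*product≤2^totient []       = ≤-refl
2*product≤2^totient {q ∷ S} (s≤s (s≤s (s≤s (s≤s (z≤n {j})))) ∷ bs) = begin
  2 * ((4 + j) * Q)              ≡⟨ l j Q ⟩
  (2 * Q) * (4 + j)              ≤⟨ *-monoʳ-≤ (2 * Q) (4+j≤x^[2+j] (*-monoʳ-≤ 2 (0<product bs)) j) ⟩
  (2 * Q) ^ (3 + j)              ≤⟨ ^-monoˡ-≤ (3 + j) (2*product≤2^totient bs) ⟩
  (2 ^ f) ^ (3 + j)              ≡⟨ ^-*-assoc 2 f (3 + j) ⟩
  2 ^ (f * (3 + j))              ≡⟨ cong (2 ^_) (*-comm f (3 + j)) ⟩
  2 ^ ((3 + j) * f)              ∎
  where
  open ≤-Reasoning
  Q = product S
  f = totient S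
  l : ∀ j Q → 2 * ((4 + j) * Q) ≡ (2 * Q) * (4 + j)
  l = solve-∀

-- A leading 3 doubles the totient, so lists starting with 3 or with 2, 3 call for the squared
-- bound.
[2*product]²≤2^[2*totient] : ∀ {S} → All (4 ≤_) S → (2 * product S) * (2 * product S) ≤ 2 ^ (2 * totient S)
[2*product]²≤2^[2*totient] {S} 4≤S = begin
  (2 * product S) * (2 * product S)    ≤⟨ *-mono-≤ (2*product≤2^totient 4≤S) (2*product≤2^totient 4≤S) ⟩
  2 ^ f * 2 ^ f                        ≡⟨ sym (^-distribˡ-+-* 2 f f) ⟩
  2 ^ (f + f)                          ≡⟨ cong (λ k → 2 ^ (f + k)) (sym (+-identityʳ f)) ⟩
  2 ^ (2 * f)                          ∎
  where
  open ≤-Reasoning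
  f = totient S

3*product≤2^[2*totient] : ∀ {S} → All (4 ≤_) S → 3 * product S ≤ 2 ^ (2 * totient S)
3*product≤2^[2*totient] {S} 4≤S = begin
  3 * Q                  ≤⟨ *-mono-≤ (n≤1+n 3) (m≤m*n Q Q {{>-nonZero (0<product 4≤S)}}) ⟩
  4 * (Q * Q)            ≡⟨ lemma Q ⟩
  (2 * Q) * (2 * Q)      ≤⟨ [2*product]²≤2^[2*totient] 4≤S ⟩
  2 ^ (2 * totient S)    ∎
  where
  open ≤-Reasoning
  Q = product S
  lemma : ∀ Q → 4 * (Q * Q) ≡ (2 * Q) * (2 * Q)
  lemma = solve-∀

6*product≤2^[2*totient] : ∀ {S} → All (4 ≤_) S → 2 ≤ product S → 2 * (3 * product S) ≤ 2 ^ (2 * totient S)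
6*product≤2^[2*totient] {S} 4≤S 2≤Q = begin
  2 * (3 * Q)            ≤⟨ *-mono-≤ 2≤Q (*-monoˡ-≤ Q (n≤1+n 3)) ⟩
  Q * (4 * Q)            ≡⟨ lemma Q ⟩
  (2 * Q) * (2 * Q)      ≤⟨ [2*product]²≤2^[2*totient] 4≤S ⟩
  2 ^ (2 * totient S)    ∎
  where
  open ≤-Reasoning
  Q = product S
  lemma : ∀ Q → Q * (4 * Q) ≡ (2 * Q) * (2 * Q)
  lemma = solve-∀

sorted⇒≥4 : ∀ {q S} → 4 ≤ q → All (q <_) S → All (4 ≤_) (q ∷ S)
sorted⇒≥4 4≤q q< = 4≤q ∷ All.map (λ q<r → ≤-trans 4≤q (<⇒≤ q<r)) q<

4≤4+n : ∀ {n} → 4 ≤ 4 + n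
4≤4+n {n} = m≤m+n 4 n

-- The exponent `totient S` suffices unless S is 2, 3, where 6 > 2². Then N ≠ 6 forces n ≥ 2, and 6
-- ≤ 2⁴.
product≤2^ : ∀ n S .{{_ : NonZero n}} → All (2 ≤_) S → AllPairs _<_ S → n * product S ≢ 6 →
  product S ≤ 2 ^ (n * totient S)
product≤2^ n S _ _ _ with product S ≤? 2 ^ totient S
... | yes Q≤ = ≤-trans Q≤ (^-monoʳ-≤ 2 (m≤n*m (totient S) n))
product≤2^ n [] _ _ _ | no Q≰ = contradiction (s≤s z≤n) Q≰
product≤2^ n (1 ∷ _) (s≤s () ∷ _) _ _ | _
product≤2^ n (2 ∷ []) _ _ _ | no Q≰ = contradiction ≤-refl Q≰
product≤2^ n (2 ∷ 1 ∷ _) _ ((s≤s () ∷ _) ∷ _) _ | _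
product≤2^ n (2 ∷ 2 ∷ _) _ ((s≤s (s≤s ()) ∷ _) ∷ _) _ | _
product≤2^ 1 (2 ∷ 3 ∷ []) _ _ N≢6 | no _ = contradiction refl N≢6
product≤2^ (suc (suc n)) (2 ∷ 3 ∷ []) _ _ _ | no _ = begin
  6                    ≤⟨ m≤m+n 6 10 ⟩
  2 ^ (2 * 2)          ≤⟨ ^-monoʳ-≤ 2 (*-monoˡ-≤ 2 (s≤s (s≤s (z≤n {n})))) ⟩
  2 ^ ((2 + n) * 2)    ∎
  where open ≤-Reasoning
product≤2^ n (2 ∷ 3 ∷ S@(q ∷ T)) _ (_ ∷ 4≤S ∷ _) _ | no Q≰ = contradiction
  (subst (λ f → product (2 ∷ 3 ∷ S) ≤ 2 ^ f) (sym (*-identityˡ (2 * totient S))) (6*product≤2^[2*totient] 4≤S 2≤Q)) Q≰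
  where
  2≤Q : 2 ≤ product S
  2≤Q = ≤-trans (≤-trans (m≤m+n 2 2) (All.head 4≤S)) (m≤m*n q (product T) {{>-nonZero (0<product (All.tail 4≤S))}})
product≤2^ n (2 ∷ S@(suc (suc (suc (suc _))) ∷ _)) _ (_ ∷ q< ∷ _) _ | no Q≰ = contradiction
  (subst (λ f → product (2 ∷ S) ≤ 2 ^ f) (sym (*-identityˡ (totient S))) (2*product≤2^totient (sorted⇒≥4 4≤4+n q<))) Q≰
product≤2^ n (3 ∷ S) _ (4≤S ∷ _) _ | no Q≰ = contradiction (3*product≤2^[2*totient] 4≤S) Q≰
product≤2^ n S@(suc (suc (suc (suc _))) ∷ _) _ (q< ∷ _) _ | no Q≰ =
  contradiction (≤-trans (m≤n*m (product S) 2) (2*product≤2^totient (sorted⇒≥4 4≤4+n q<))) Q≰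

-- Prime divisors and squarefree numbers.

prime-divisor : ∀ {n} → n ≢ 1 → ∃[ p ] Prime p × p ∣ n
prime-divisor {zero}  _   = 2 , prime[2] , 2 ∣0
prime-divisor n@{suc _} n≢1 with factorise n
... | record { factors = [] ; isFactorisation = e } = contradiction e n≢1
... | record { factors = p ∷ ps ; isFactorisation = e ; factorsPrime = pp ∷ _ } = p , pp , subst (p ∣_) (sym e) (m∣m*n (product ps))

squarefree∣product : ∀ S {d} → (∀ {p} → Prime p → p ∣ d → p ∈ S × ¬ p * p ∣ d) → d ∣ product S
squarefree∣product [] {d} h with d ≟ 1
... | yes refl = ∣-refl
... | no  d≢1  with p , pp , p∣d ← prime-divisor d≢1 = contradiction (proj₁ (h pp p∣d)) λ ()
squarefree∣product (q ∷ S) {d} h with q ∣? d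
... | yes (divides d′ refl) = subst (_∣ q * product S) (*-comm q d′) (*-monoʳ-∣ q (squarefree∣product S h′))
  where
  h′ : ∀ {p} → Prime p → p ∣ d′ → p ∈ S × ¬ p * p ∣ d′
  h′ pp p∣d′ with h pp (∣m⇒∣m*n q p∣d′)
  -- The prime just divided out cannot divide d′ again, since its square would divide d.
  ... | here refl , p²∤ = contradiction (*-pres-∣ p∣d′ ∣-refl) p²∤
  ... | there p∈S , p²∤ = p∈S , λ p²∣ → p²∤ (∣m⇒∣m*n q p²∣)
... | no q∤d = ∣n⇒∣m*n q (squarefree∣product S h′)
  where
  h′ : ∀ {p} → Prime p → p ∣ d → p ∈ S × ¬ p * p ∣ d
  h′ pp p∣d with h pp p∣d
  ... | here refl , _   = contradiction p∣d q∤d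
  ... | there p∈S , p²∤ = p∈S , p²∤

product-primes∣ : ∀ {S N} → All Prime S → AllPairs _<_ S → All (_∣ N) S → product S ∣ N
product-primes∣ [] _ _ = 1∣ _
product-primes∣ {q ∷ S} (pq ∷ ps) (q< ∷ <s) (divides m refl ∷ ∣s) =
  subst (q * product S ∣_) (*-comm q m) (*-monoʳ-∣ q (product-primes∣ ps <s (All.zipWith cancel (All.zip (ps , q<) , ∣s))))
  where
  cancel : ∀ {r} → (Prime r × q < r) × r ∣ m * q → r ∣ m
  cancel ((pr , q<r) , r∣mq) with euclidsLemma m q pr r∣mq
  ... | inj₁ r∣m = r∣m
  ... | inj₂ r∣q = contradiction (prime∣prime pr pq r∣q) (>⇒≢ q<r)

pairwise-coprime : ∀ {S} → All Prime S → AllPairs _<_ S → AllPairs Coprime S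
pairwise-coprime []        []       = []
pairwise-coprime {q ∷ _} (pq ∷ ps) (q< ∷ <s) =
  All.map {Q = Coprime q} (λ (pr , q<r) → Coprimality.sym (prime⇒coprime pr {{prime⇒nonZero pq}} q<r)) (All.zip (ps , q<)) ∷ pairwise-coprime ps <s

prime≥2 : ∀ {p} → Prime p → 2 ≤ p
prime≥2 pp = nonTrivial⇒n>1 _ {{prime⇒nonTrivial pp}}

∈⇒u∣properLcm : ∀ n S {q} → q ∈ S → ∃[ m ] n * product S ≡ q * m × u m ∣ properLcm n S
∈⇒u∣properLcm n (q ∷ S) (here refl) = n * product S , l n q (product S) , n∣lcm[m,n] (properLcm (q * n) S) _
  where
  l : ∀ n q Q → n * (q * Q) ≡ q * (n * Q)
  l = solve-∀
∈⇒u∣properLcm n (r ∷ S) (there q∈S) with ∈⇒u∣properLcm (r * n) S q∈S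
... | m , eq , um∣ = m , trans (sym ([q*n]*m≡n*[q*m] r n (product S))) eq , ∣-trans um∣ (m∣lcm[m,n] (properLcm (r * n) S) _)

-- Nonprimitive prime divisors of u N / L.

-- A prime p dividing both u N / properLcm n S and some u j with 0 < j < N is one of the
-- prime divisors q of N, because it divides u (N / q) and u N / u (N / q).
module NonPrimitive (n q₀ : ℕ) (S₀ : List ℕ) .{{_ : NonZero n}}
  (primes : All Prime (q₀ ∷ S₀)) (sorted : AllPairs _<_ (q₀ ∷ S₀))
  (complete : ∀ {p} → Prime p → p ∣ n * product (q₀ ∷ S₀) → p ∈ q₀ ∷ S₀) where

  S = q₀ ∷ S₀
  N = n * product S
  L = properLcm n S

  instance
    N≢0 : NonZero N
    N≢0 = m*n≢0 n (product S) {{it}} {{productOfPrimes≢0 primes}}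

  d = quotient (properLcm∣u n S)

  uN≡dL : u N ≡ d * L
  uN≡dL = m∣n⇒n≡quotient*m (properLcm∣u n S)

  prime-of-quotient : ∀ {p j} → Prime p → p ∣ d → .{{_ : NonZero j}} → j < N → p ∣ u j → p ∈ S × ¬ p * p ∣ d
  prime-of-quotient {p} {j} pp p∣d j<N p∣uj
    with gcd j N in g≡ | gcd[m,n]∣m j N | gcd[m,n]∣n j N | ∣u-gcd j N p∣uj (subst (p ∣_) (sym uN≡dL) (∣m⇒∣m*n L p∣d))
  ... | g | g∣j | divides h N≡hg | p∣ug
    -- The cofactor h = N / g is not 1 because g ≤ j < N. A prime q dividing it makes g a divisor of
    -- N / q.
    with prime-divisor {h} (λ { refl → <⇒≱ j<N (subst (_≤ j) (trans (sym (*-identityˡ g)) (sym N≡hg)) (∣⇒≤ g∣j)) })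
  ... | q , pq , divides h′ h≡ with complete pq (divides (h′ * g) (trans N≡hg (trans (cong (_* g) h≡) (l h′ q g))))
    where
    l : ∀ h q g → h * q * g ≡ h * g * q
    l = solve-∀
  ... | q∈S with ∈⇒u∣properLcm n S q∈S
  -- Here m = N / q and u N / u m = d e, so divisors of d divide this quotient: p forces p = q, and
  -- p² is excluded by `prime²∤quotient`.
  ... | m , N≡qm , divides e L≡e*um = p∈S , λ p²∣d →
    prime²∤quotient {m = m} {{um≢0}} pp (subst (λ q → u (q * m) ≡ u m * (d * e)) (sym p≡q) uqm≡) p∣um (∣m⇒∣m*n e p²∣d)
    where
    open ≡-Reasoning
    m≢0 : NonZero m
    m≢0 = m*n≢0⇒n≢0 q {{subst NonZero N≡qm N≢0}}
    um≢0 : NonZero (u m)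
    um≢0 = u-nonZero m {{m≢0}}
    c₁ : ∀ q h g → q * (h * g) ≡ h * q * g
    c₁ = solve-∀
    c₂ : ∀ d e m → d * (e * m) ≡ m * (d * e)
    c₂ = solve-∀
    m≡ : m ≡ h′ * g
    m≡ = *-cancelˡ-≡ m (h′ * g) q {{prime⇒nonZero pq}} (begin
      q * m             ≡⟨ sym N≡qm ⟩
      N                 ≡⟨ N≡hg ⟩
      h * g             ≡⟨ cong (_* g) h≡ ⟩
      h′ * q * g        ≡⟨ sym (c₁ q h′ g) ⟩
      q * (h′ * g)      ∎)
    p∣um : p ∣ u m
    p∣um = ∣-trans p∣ug (u-∣ (divides h′ m≡))
    uqm≡ : u (q * m) ≡ u m * (d * e)
    uqm≡ = begin
      u (q * m)          ≡⟨ cong u (sym N≡qm) ⟩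
      u N                ≡⟨ uN≡dL ⟩
      d * L              ≡⟨ cong (d *_) L≡e*um ⟩
      d * (e * u m)      ≡⟨ c₂ d e (u m) ⟩
      u m * (d * e)      ∎
    p∣q : ∀ {q} → Prime q → u (q * m) ≡ u m * (d * e) → p ∣ q
    p∣q {0} pq _ = contradiction pq ¬prime[0]
    p∣q {1} pq _ = contradiction pq ¬prime[1]
    p∣q {suc (suc k)} pq eq = prime∣quotient⇒∣index {m} {{um≢0}} pp k eq p∣um (∣m⇒∣m*n e p∣d)
    p≡q : p ≡ q
    p≡q = prime∣prime pp pq (p∣q pq uqm≡)
    p∈S : p ∈ S
    p∈S = subst (_∈ S) (sym p≡q) q∈S

  k = 2 ^ length S₀
  t = n * totient S

  -- The lower estimate at x = 0, where u 1 = 1, with L cancelled.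
  u≤quotient : 5 ^ k * u (suc t) ≤ 6 ^ k * d
  u≤quotient = *-cancelʳ-≤ _ _ L {{∣-nonZero {{u-nonZero N}} (properLcm∣u n S)}} (begin
    5 ^ k * u (suc t) * L          ≡⟨ c₁ (5 ^ k) (u (suc t)) L ⟩
    5 ^ k * (L * u (suc t))        ≤⟨ Near.lower (near-properLcm n q₀ S₀ (All.map prime⇒nonZero primes) (pairwise-coprime primes sorted)) 0 ⟩
    6 ^ k * (u N * 1)              ≡⟨ cong (6 ^ k *_) (trans (*-identityʳ (u N)) uN≡dL) ⟩
    6 ^ k * (d * L)                ≡⟨ sym (*-assoc (6 ^ k) d L) ⟩
    6 ^ k * d * L                  ∎)
    where
    open ≤-Reasoning
    c₁ : ∀ a v l → a * v * l ≡ a * (l * v)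
    c₁ = solve-∀

  k≤t : k ≤ t
  k≤t = ≤-trans
    -- The least prime may be 2 and contributes only 1 to the totient; the primes in `S₀` are at
    -- least 3 and contribute at least 2 each.
    (subst (_≤ totient S) (*-identityˡ k) (*-mono-≤ (pred-mono-≤ 2≤q₀) (2^length≤totient (All.map (λ q₀<r → ≤-trans (s≤s 2≤q₀) q₀<r) (AllPairs.head sorted)))))
    (m≤n*m (totient S) n)
    where
    2≤q₀ = prime≥2 (All.head primes)

  -- Otherwise d ≤ ∏ S ≤ 2^t, while d ≥ (5/6)^k (5/2)^t; then (5/4)^t ≤ (6/5)^k, impossible for 0 <
  -- k ≤ t.
  quotient∤product : N ≢ 6 → ¬ d ∣ product S
  quotient∤product N≢6 d∣Q = <⇒≱ (6^k*4^t<5^k*5^t (m^n>0 2 (length S₀)) k≤t) (begin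
    5 ^ k * 5 ^ t                          ≤⟨ *-monoʳ-≤ (5 ^ k) (u-lower t) ⟩
    5 ^ k * (2 ^ t * u (suc t))            ≡⟨ c₁ (5 ^ k) (2 ^ t) (u (suc t)) ⟩
    2 ^ t * (5 ^ k * u (suc t))            ≤⟨ *-monoʳ-≤ (2 ^ t) u≤quotient ⟩
    2 ^ t * (6 ^ k * d)                    ≤⟨ *-monoʳ-≤ (2 ^ t) (*-monoʳ-≤ (6 ^ k) d≤2^t) ⟩
    2 ^ t * (6 ^ k * 2 ^ t)                ≡⟨ c₂ (2 ^ t) (6 ^ k) ⟩
    6 ^ k * (2 ^ t * 2 ^ t)                ≡⟨ cong (6 ^ k *_) (sym (^-distribˡ-+-* 2 t t)) ⟩
    6 ^ k * 2 ^ (t + t)                    ≡⟨ cong (λ s → 6 ^ k * 2 ^ (t + s)) (sym (+-identityʳ t)) ⟩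
    6 ^ k * 2 ^ (2 * t)                    ≡⟨ cong (6 ^ k *_) (sym (^-*-assoc 2 2 t)) ⟩
    6 ^ k * 4 ^ t                          ∎)
    where
    open ≤-Reasoning
    d≤2^t : d ≤ 2 ^ t
    d≤2^t = ≤-trans (∣⇒≤ {{productOfPrimes≢0 primes}} d∣Q) (product≤2^ n S (All.map prime≥2 primes) sorted N≢6)
    c₁ : ∀ a b c → a * (b * c) ≡ b * (a * c)
    c₁ = solve-∀
    c₂ : ∀ a b → a * (b * a) ≡ b * (a * a)
    c₂ = solve-∀

-- Products of odd-indexed Fibonacci numbers.

prime∣FibProd : ∀ {p b} → Prime p → ∀ {ms} → All (_< b) ms → p ∣ FibProd ms → ∃[ m ] m < b × p ∣ u (suc m)
prime∣FibProd pp [] p∣1 = contradiction p∣1 (prime∤1 pp)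
prime∣FibProd {p} pp {m ∷ ms} (m<b ∷ <bs) p∣ with euclidsLemma (Fodd m) (FibProd ms) pp p∣
... | inj₁ p∣F = m , m<b , subst (p ∣_) (sym (u≡Fodd m)) p∣F
... | inj₂ p∣P = prime∣FibProd pp <bs p∣P

-- Reduces the exceptional index N = 6 to a single numerical check.
FibProd∣FibProd-downFrom : ∀ b {ms} → AllPairs _>_ ms → All (_< b) ms → FibProd ms ∣ FibProd (downFrom b)
FibProd∣FibProd-downFrom b       []        _          = 1∣ _
FibProd∣FibProd-downFrom (suc b) {m ∷ ms} (m> ∷ >s) (m≤b ∷ _) with m ≟ b
... | yes refl = *-monoʳ-∣ (Fodd m) (FibProd∣FibProd-downFrom b >s m>)
... | no  m≢b  = ∣n⇒∣m*n (Fodd b) (FibProd∣FibProd-downFrom b (m> ∷ >s) (m<b ∷ All.map (λ r<m → <-trans r<m m<b) m>))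
  where
  m<b = ≤∧≢⇒< (s≤s⁻¹ m≤b) m≢b

Fodd∤FibProd : ∀ a {ms} → 0 < a → AllPairs _>_ ms → All (_< a) ms → ¬ Fodd a ∣ FibProd ms
Fodd∤FibProd a 0<a >s <as Fa∣ with a ≟ 5
-- Here N = 6, `Fodd 5` is 144, and 27720 is the product of all `Fodd m` with m < 5.
... | yes refl = toWitnessFalse {a? = 144 ∣? 27720} _ (∣-trans Fa∣ (FibProd∣FibProd-downFrom 5 >s <as))
... | no  a≢5 = go S (all-filter P? (upTo (2 + a))) (AllPairs.filter⁺ P? (AllPairs.applyUpTo⁺₁ (λ i → i) (2 + a) (λ i<j _ → i<j)))
    (λ pp p∣ → ∈-filter⁺ P? (∈-upTo⁺ (s≤s (∣⇒≤ p∣))) (pp , p∣))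
  where
  P? = λ p → prime? p ×-dec p ∣? suc a
  -- The range includes a + 1, which may itself be prime.
  S = filter P? (upTo (2 + a))
  -- The list is abstracted so that its head can be exposed for `NonPrimitive`; it is nonempty
  -- because a + 1 ≥ 2.
  go : ∀ S → All (λ p → Prime p × p ∣ suc a) S → AllPairs _<_ S → (∀ {p} → Prime p → p ∣ suc a → p ∈ S) → ⊥
  go [] _ _ complete with prime-divisor {suc a} (λ { refl → n≮0 0<a })
  ... | p , pp , p∣ = contradiction (complete pp p∣) λ ()
  go (q ∷ S) props sorted complete with product-primes∣ (All.map proj₁ props) sorted (All.map proj₂ props)
  ... | divides n a≡ = M.quotient∤product (λ N≡6 → a≢5 (suc-injective (trans a≡ N≡6))) (squarefree∣product (q ∷ S) h)
    where
    n≢0 : NonZero n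
    n≢0 = m*n≢0⇒m≢0 n {{subst NonZero a≡ it}}
    module M = NonPrimitive n q S {{n≢0}} (All.map proj₁ props) sorted (λ {p} pp p∣ → complete pp (subst (p ∣_) (sym a≡) p∣))
    h : ∀ {p} → Prime p → p ∣ M.d → p ∈ q ∷ S × ¬ p * p ∣ M.d
    h {p} pp p∣d with prime∣FibProd pp <as (∣-trans
      (subst (p ∣_) (trans (sym M.uN≡dL) (trans (cong u (sym a≡)) (u≡Fodd a))) (∣m⇒∣m*n M.L p∣d)) Fa∣)
    ... | m , m<a , p∣um = M.prime-of-quotient pp p∣d (subst (suc m <_) a≡ (s≤s m<a)) p∣um

-- Equal heads cancel. Otherwise the larger head exceeds every entry of the other list, yet its
-- `Fodd` divides the common product, against `Fodd∤FibProd`.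
FibProd-injective : ∀ {ns ms} → AllPairs _>_ ns → Positive ns → AllPairs _>_ ms → Positive ms →
  FibProd ns ≡ FibProd ms → ns ≡ ms
FibProd-injective [] _ [] _ _ = refl
FibProd-injective {ms = m ∷ ms} [] _ _ (0<m ∷ _) eq =
  contradiction (subst (Fodd m ∣_) (sym eq) (m∣m*n (FibProd ms))) (Fodd∤FibProd m 0<m [] [])
FibProd-injective {n ∷ ns} _ (0<n ∷ _) [] _ eq =
  contradiction (subst (Fodd n ∣_) eq (m∣m*n (FibProd ns))) (Fodd∤FibProd n 0<n [] [])
FibProd-injective {n ∷ ns} {m ∷ ms} (n> ∷ >ns) (0<n ∷ +ns) (m> ∷ >ms) (0<m ∷ +ms) eq with <-cmp n m
... | tri< n<m _ _ = contradiction (subst (Fodd m ∣_) (sym eq) (m∣m*n (FibProd ms)))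
      (Fodd∤FibProd m 0<m (n> ∷ >ns) (n<m ∷ All.map (λ r<n → <-trans r<n n<m) n>))
... | tri> _ _ m<n = contradiction (subst (Fodd n ∣_) eq (m∣m*n (FibProd ns)))
      (Fodd∤FibProd n 0<n (m> ∷ >ms) (m<n ∷ All.map (λ r<m → <-trans r<m m<n) m>))
... | tri≈ _ refl _ = cong (n ∷_) (FibProd-injective >ns +ns >ms +ms
      (*-cancelˡ-≡ _ _ (Fodd n) {{subst NonZero (u≡Fodd n) (u-nonZero (suc n))}} eq))

theorem3p6 : (ns ms : List ℕ) → StrictDec ns → Positive ns → StrictDec ms → Positive ms →
    ns ≻ ms → FibProd ns ≡ FibProd ms → ns ≡ ms
theorem3p6 ns ms >ns +ns >ms +ms _ = FibProd-injective (Linked⇒AllPairs (flip <-trans) >ns) +ns (Linked⇒AllPairs (flip <-trans) >ms) +ms
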